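{- For every $\beta$ with $Spr(\beta)$ and all $\alpha,\delta\in\mathcal{F}_\beta$: $\alpha\#\delta$ if and only if $(\mathcal{F}_\beta,=)\models AP[\alpha,\delta]$, i.e. if and only if $\forall\gamma\in\mathcal{F}_\beta[\neg(\gamma=\alpha)\vee\neg(\gamma=\delta)]$.
   Context: Intuitionistic mathematics (constructive reading of logical constants; Markov's Principle not assumed), with Brouwer's Continuity Principle as an axiom: for every $R\subseteq\mathcal{N}\times\omega$, if $\forall\alpha\exists n[\alpha R n]$, then $\forall\alpha\exists m\exists n\forall\beta[\overline{\alpha}m\sqsubset\beta\rightarrow\beta R n]$. $\mathcal{N}=\omega^\omega$; finite sequences of naturals are coded by naturals, $\overline{\alpha}m=\langle\alpha(0),\dots,\alpha(m-1)\rangle$, $s\sqsubset\beta$ means $s$ is an initial segment of $\beta$, $s\ast\langle n\rangle$ extends $s$ by $n$. $\alpha\#\delta$ means $\exists n[\alpha(n)\neq\delta(n)]$; $\alpha=\delta$ means $\forall n[\alpha(n)=\delta(n)]$. $\mathcal{F}_\beta:=\{\alpha\mid\forall n[\beta(\overline{\alpha}n)=0]\}$; $Spr(\beta)$ iff $\forall s[\beta(s)=0\leftrightarrow\exists n[\beta(s\ast\langle n\rangle)=0]]$. $AP(\mathsf{x},\mathsf{y})$ is the formula $\forall\mathsf{z}[\neg(\mathsf{z}=\mathsf{x})\vee\neg(\mathsf{z}=\mathsf{y})]$; satisfaction $\models$ is Tarskian with intuitionistic reading, and $=$ interpreted by equality on $\mathcal{F}_\beta$. -}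

module Defs where

open import Data.Fin using (Fin; zero; suc)
open import Data.Irrelevant using ([_])
open import Data.List using (List; []; _∷_; _++_; length; applyUpTo)
open import Data.Nat using (ℕ; zero; suc; _+_; _*_; _^_; _≤_; _<_; _≟_)
open import Data.Nat.Induction using (<-rec)
open import Data.Nat.Properties using (anyUpTo?; ≤-antisym; ≮⇒≥)
open import Data.Product using (∃; ∃₂; _×_; _,_; proj₁)
open import Data.Refinement using (Refinement; _,_)
open import Data.Sum using (_⊎_)
open import Data.Vec using (Vec; _∷_; lookup)
open import Function.Bundles using (_⇔_)
open import Level using (Level; Lift; 0ℓ; _⊔_) renaming (suc to lsuc)
open import Relation.Binary.Bundles using (Setoid)
open import Relation.Binary.PropositionalEquality using (_≡_; _≢_; _≗_; refl; _→-setoid_)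
import Relation.Binary.Construct.On as On
open import Relation.Nullary using (¬_; Irrelevant; yes; no; recompute)
open import Relation.Unary using (Pred; Decidable)
open import Relation.Binary.Definitions using (_Respects_)

private
  variable
    a b : Level

-- Propositional truncation, by its elimination principle.  The intuitionistic
-- ∃ and ∨ are read throughout as truncated Σ and ⊎.  With untruncated Σ the
-- Continuity Principle below would be refutable (Escardó and Xu, TLCA 2015):
-- it would yield a modulus of continuity as a (non-extensional) function.
∥_∥ : Set a → Set (a ⊔ lsuc 0ℓ)
∥ A ∥ = (P : Set) → Irrelevant P → (A → P) → P

infixr 1 _∨_
_∨_ : Set a → Set b → Set (a ⊔ b ⊔ lsuc 0ℓ)
A ∨ B = ∥ A ⊎ B ∥

-- Truncation loses nothing for decidable properties of numbers, such as those
-- in the definitions of _#_ and Spr: the least witness can be recovered.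
module _ {P : Pred ℕ 0ℓ} (P? : Decidable P) where

  private
    Least : ℕ → Set
    Least n = P n × (∀ m → P m → n ≤ m)

    least : ∀ n → P n → ∃ Least
    least = <-rec (λ n → P n → ∃ Least) λ n rec Pn → step n rec Pn
      where
      step : ∀ n → (∀ {m} → m < n → P m → ∃ Least) → P n → ∃ Least
      step n rec Pn with anyUpTo? P? n
      ... | yes (m , m<n , Pm) = rec m<n Pm
      ... | no none = n , Pn , λ m Pm → ≮⇒≥ λ m<n → none (m , m<n , Pm)

    unique : Irrelevant (Refinement ℕ Least)
    unique (m , [ p ]) (n , [ q ]) with recompute (m ≟ n) (antisym p q)
      where
      antisym : Least m → Least n → m ≡ n
      antisym (Pm , m≤) (Pn , n≤) = ≤-antisym (m≤ n Pn) (n≤ m Pm)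
    ... | refl = refl

  witness : ∥ ∃ P ∥ → ∃ P
  witness h with h (Refinement ℕ Least) unique
                   (λ (n , Pn) → let m , l = least n Pn in m , [ l ])
  ... | m , [ l ] = m , recompute (P? m) (proj₁ l)

𝒩 : Set
𝒩 = ℕ → ℕ

-- A bijection List ℕ → ℕ, so quantifying over lists s amounts to quantifying
-- over all code numbers.
⟨_⟩ : List ℕ → ℕ
⟨ [] ⟩    = 0
⟨ n ∷ s ⟩ = 2 ^ n * (2 * ⟨ s ⟩ + 1)

-- The initial segment of α of length m.
_↾_ : 𝒩 → ℕ → List ℕ
α ↾ m = applyUpTo α m

infix 4 _⊏_ _#_

_⊏_ : List ℕ → 𝒩 → Set
s ⊏ β = β ↾ length s ≡ s

_#_ : 𝒩 → 𝒩 → Set₁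
α # δ = ∥ (∃ λ n → α n ≢ δ n) ∥

𝓕 : 𝒩 → Pred 𝒩 0ℓ
𝓕 β α = ∀ n → β ⟨ α ↾ n ⟩ ≡ 0

Spr : 𝒩 → Set₁
Spr β = ∀ s → β ⟨ s ⟩ ≡ 0 ⇔ ∥ (∃ λ n → β ⟨ s ++ n ∷ [] ⟩ ≡ 0) ∥

-- Brouwer's Continuity Principle.  A subset R of 𝒩 × ω is a proposition-valued
-- relation that respects the (pointwise) equality of 𝒩.
BCP : Set₁
BCP = (R : 𝒩 → ℕ → Set) →
      (∀ α n → Irrelevant (R α n)) →
      (∀ n → (λ α → R α n) Respects _≗_) →
      (∀ α → ∥ (∃ λ n → R α n) ∥) →
      ∀ α → ∥ (∃₂ λ m n → ∀ β → (α ↾ m) ⊏ β → R β n) ∥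

-- First-order formulas over the empty signature with equality, with free
-- variables (de Bruijn indices) in Fin n.
infix 8 _≐_
infix 7 ¬′_
infixr 6 _∧′_
infixr 5 _∨′_
infixr 4 _⇒′_

data Formula (n : ℕ) : Set where
  _≐_            : (x y : Fin n) → Formula n
  ¬′_            : Formula n → Formula n
  _∧′_ _∨′_ _⇒′_ : (φ ψ : Formula n) → Formula n
  ∀′ ∃′          : Formula (suc n) → Formula n

infix 3 _⊨_[_]

_⊨_[_] : ∀ {n} (𝔄 : Setoid 0ℓ 0ℓ) → Formula n → Vec (Setoid.Carrier 𝔄) n → Set₁
𝔄 ⊨ x ≐ y [ ρ ]  = Lift (lsuc 0ℓ) (Setoid._≈_ 𝔄 (lookup ρ x) (lookup ρ y))
𝔄 ⊨ ¬′ φ [ ρ ]   = ¬ (𝔄 ⊨ φ [ ρ ])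
𝔄 ⊨ φ ∧′ ψ [ ρ ] = (𝔄 ⊨ φ [ ρ ]) × (𝔄 ⊨ ψ [ ρ ])
𝔄 ⊨ φ ∨′ ψ [ ρ ] = (𝔄 ⊨ φ [ ρ ]) ∨ (𝔄 ⊨ ψ [ ρ ])
𝔄 ⊨ φ ⇒′ ψ [ ρ ] = 𝔄 ⊨ φ [ ρ ] → 𝔄 ⊨ ψ [ ρ ]
𝔄 ⊨ ∀′ φ [ ρ ]   = ∀ z → 𝔄 ⊨ φ [ z ∷ ρ ]
𝔄 ⊨ ∃′ φ [ ρ ]   = ∥ (∃ λ z → 𝔄 ⊨ φ [ z ∷ ρ ]) ∥

-- AP(x, y), where x and y are the free variables 0 and 1.
AP : Formula 2
AP = ∀′ (¬′ (z ≐ x) ∨′ ¬′ (z ≐ y))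
  where
  z x y : Fin 3
  z = zero
  x = suc zero
  y = suc (suc zero)

-- The structure (𝓕 β , =).
⟦𝓕_⟧ : 𝒩 → Setoid 0ℓ 0ℓ
⟦𝓕 β ⟧ = On.setoid (ℕ →-setoid ℕ) (proj₁ {B = 𝓕 β})

{-# OPTIONS --safe #-}

-- If ¬ (γ = α) ∨ ¬ (γ = δ) holds for all γ in a set containing every sequence
-- each of whose initial segments is one of α or of δ, then it holds for all γ in 𝒩:
-- replace γ by the sequence that follows α and δ as long as they agree and, at
-- their first difference i, settles for δ if γ i = δ i and for α otherwise.
-- Brouwer's Continuity Principle at α now chooses one disjunct for all γ sharing
-- some initial segment of α.  It is not the first one, as γ = α shows, so δ does
-- not share this initial segment.
module Submission where

open import Defs
open import Data.Empty using (⊥-elim-irr)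
open import Data.Irrelevant using (Irrelevant; [_])
open import Data.List using (_∷_)
open import Data.Nat using (ℕ; zero; suc; _≟_)
open import Data.Product using (∃; _×_; _,_)
open import Data.Sum using (_⊎_; inj₁; inj₂; map)
open import Data.Vec using ([]; _∷_)
open import Function.Base using (_∘_)
open import Function.Bundles using (_⇔_; mk⇔)
open import Function.Construct.Composition using (_⇔-∘_)
open import Level using (lift; lower)
open import Relation.Binary.PropositionalEquality using (_≡_; _≢_; _≗_; refl; sym; trans; cong; cong₂; subst)
open import Relation.Nullary using (¬_; yes; no; contradiction)
open import Relation.Unary using (_∈_)

∨-map : ∀ {a b c d} {A : Set a} {B : Set b} {C : Set c} {D : Set d} →
        (A → C) → (B → D) → A ∨ B → C ∨ D
∨-map f g h P irr k = h P irr (k ∘ map f g)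

-- Recursion on the position, passing to tails while the heads agree, avoids having to decide
-- whether `α` and `δ` differ anywhere.
follow : 𝒩 → 𝒩 → 𝒩 → 𝒩
follow α δ γ n with α 0 ≟ δ 0 | γ 0 ≟ δ 0
follow α δ γ n       | no _  | yes _ = δ n
follow α δ γ n       | no _  | no _  = α n
follow α δ γ zero    | yes _ | _     = α 0
follow α δ γ (suc n) | yes _ | _     = follow (α ∘ suc) (δ ∘ suc) (γ ∘ suc) n

-- Used contrapositively, with `follow-≗ʳ`, to carry a disjunction about `follow α δ γ` back to `γ`.
follow-≗ˡ : ∀ α δ γ → γ ≗ α → follow α δ γ ≗ α
follow-≗ˡ α δ γ γ≗α n with α 0 ≟ δ 0 | γ 0 ≟ δ 0
follow-≗ˡ α δ γ γ≗α n       | no α≢δ | yes γ≡δ = contradiction (trans (sym (γ≗α 0)) γ≡δ) α≢δ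
follow-≗ˡ α δ γ γ≗α n       | no _   | no _    = refl
follow-≗ˡ α δ γ γ≗α zero    | yes _  | _       = refl
follow-≗ˡ α δ γ γ≗α (suc n) | yes _  | _       =
  follow-≗ˡ (α ∘ suc) (δ ∘ suc) (γ ∘ suc) (γ≗α ∘ suc) n

follow-≗ʳ : ∀ α δ γ → γ ≗ δ → follow α δ γ ≗ δ
follow-≗ʳ α δ γ γ≗δ n with α 0 ≟ δ 0 | γ 0 ≟ δ 0
follow-≗ʳ α δ γ γ≗δ n       | no _    | yes _  = refl
follow-≗ʳ α δ γ γ≗δ n       | no _    | no γ≢δ = contradiction (γ≗δ 0) γ≢δ
follow-≗ʳ α δ γ γ≗δ zero    | yes α≡δ | _      = α≡δ
follow-≗ʳ α δ γ γ≗δ (suc n) | yes _   | _      =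
  follow-≗ʳ (α ∘ suc) (δ ∘ suc) (γ ∘ suc) (γ≗δ ∘ suc) n

follow-↾ : ∀ α δ γ n → (follow α δ γ ↾ n ≡ α ↾ n) ⊎ (follow α δ γ ↾ n ≡ δ ↾ n)
follow-↾ α δ γ zero = inj₁ refl
follow-↾ α δ γ (suc n) with α 0 ≟ δ 0 | γ 0 ≟ δ 0
... | no _    | yes _ = inj₂ refl
... | no _    | no _  = inj₁ refl
... | yes α≡δ | _     = map (cong (α 0 ∷_)) (cong₂ _∷_ α≡δ)
                            (follow-↾ (α ∘ suc) (δ ∘ suc) (γ ∘ suc) n)

follow-∈ : ∀ β α δ γ → α ∈ 𝓕 β → δ ∈ 𝓕 β → follow α δ γ ∈ 𝓕 β
follow-∈ β α δ γ α∈ δ∈ n with follow-↾ α δ γ n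
... | inj₁ eq = subst (λ s → β ⟨ s ⟩ ≡ 0) (sym eq) (α∈ n)
... | inj₂ eq = subst (λ s → β ⟨ s ⟩ ≡ 0) (sym eq) (δ∈ n)

-- A bounded search: only the first `m` values are compared, so a failure comes with its position.
⊏⊎≢ : ∀ α δ m → (α ↾ m ⊏ δ) ⊎ ∃ (λ n → α n ≢ δ n)
⊏⊎≢ α δ zero = inj₁ refl
⊏⊎≢ α δ (suc m) with α 0 ≟ δ 0
... | no α≢δ  = inj₂ (0 , α≢δ)
... | yes α≡δ = map (cong₂ _∷_ (sym α≡δ)) (λ (n , α≢δ) → suc n , α≢δ)
                    (⊏⊎≢ (α ∘ suc) (δ ∘ suc) m)

↾-⊏ : ∀ α m → α ↾ m ⊏ α
↾-⊏ α zero    = refl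
↾-⊏ α (suc m) = cong (α 0 ∷_) (↾-⊏ (α ∘ suc) m)

#⇒≢∨≢ : ∀ {α δ} → α # δ → ∀ γ → ¬ (γ ≗ α) ∨ ¬ (γ ≗ δ)
#⇒≢∨≢ {α} {δ} α#δ γ P irr k = α#δ P irr λ (n , α≢δ) → k (split n α≢δ)
  where
  split : ∀ n → α n ≢ δ n → ¬ (γ ≗ α) ⊎ ¬ (γ ≗ δ)
  -- At `n`, `γ` cannot agree with both `α` and `δ`.
  split n α≢δ with γ n ≟ α n
  ... | yes γ≡α = inj₂ λ γ≗δ → α≢δ (trans (sym γ≡α) (γ≗δ n))
  ... | no γ≢α  = inj₁ λ γ≗α → γ≢α (γ≗α n)

≢∨≢⇒# : BCP → ∀ {α δ} → (∀ γ → ¬ (γ ≗ α) ∨ ¬ (γ ≗ δ)) → α # δ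
≢∨≢⇒# bcp {α} {δ} ap P irr k = bcp R (λ _ _ _ _ → refl) R-resp R-total α P irr λ where
    (m , zero  , R₀) → contradiction (λ _ → refl) (unbox (R₀ α (↾-⊏ α m)))
    (m , suc _ , R₁) → k (apart m R₁)
  where
  -- Codes the two disjuncts by numbers; as continuity may return any number, every positive one
  -- stands for `δ`.
  target : ℕ → 𝒩
  target zero    = α
  target (suc _) = δ

  -- Without function extensionality a negation is not provably a proposition,
  -- hence the irrelevant box.
  R : 𝒩 → ℕ → Set
  R γ n = Irrelevant (¬ (γ ≗ target n))

  -- A boxed refutation remains usable, since it only serves to reach an absurdity.
  unbox : ∀ {A : Set} → Irrelevant (¬ A) → ¬ A
  unbox [ ¬a ] a = ⊥-elim-irr (¬a a)

  R-resp : ∀ n {γ γ′} → γ ≗ γ′ → R γ n → R γ′ n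
  R-resp n γ≗γ′ [ γ≢ ] = [ (λ γ′≗ → γ≢ λ i → trans (γ≗γ′ i) (γ′≗ i)) ]

  R-total : ∀ γ → ∥ ∃ (R γ) ∥
  R-total γ Q irrQ kQ = ap γ Q irrQ λ where
    (inj₁ γ≢α) → kQ (0 , [ γ≢α ])
    (inj₂ γ≢δ) → kQ (1 , [ γ≢δ ])

  apart : ∀ m → (∀ γ → α ↾ m ⊏ γ → Irrelevant (¬ (γ ≗ δ))) → ∃ λ n → α n ≢ δ n
  apart m R₁ with ⊏⊎≢ α δ m
  -- If `δ` shared the segment, continuity would make `δ` differ from itself.
  ... | inj₁ α⊏δ = contradiction (λ _ → refl) (unbox (R₁ δ α⊏δ))
  ... | inj₂ α≢δ = α≢δ

#⇔≢∨≢ : BCP → ∀ β α δ → α ∈ 𝓕 β → δ ∈ 𝓕 β →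
        α # δ ⇔ (∀ γ → γ ∈ 𝓕 β → ¬ (γ ≗ α) ∨ ¬ (γ ≗ δ))
#⇔≢∨≢ bcp β α δ α∈ δ∈ = mk⇔ (λ α#δ γ _ → #⇒≢∨≢ α#δ γ) λ ap → ≢∨≢⇒# bcp λ γ →
  -- The hypothesis covers only `𝓕 β`, while `BCP` speaks of all of `𝒩`; `follow` bridges the gap.
  ∨-map (_∘ follow-≗ˡ α δ γ) (_∘ follow-≗ʳ α δ γ)
        (ap (follow α δ γ) (follow-∈ β α δ γ α∈ δ∈))

≢∨≢⇔AP : ∀ β α δ (α∈ : α ∈ 𝓕 β) (δ∈ : δ ∈ 𝓕 β) →
         (∀ γ → γ ∈ 𝓕 β → ¬ (γ ≗ α) ∨ ¬ (γ ≗ δ)) ⇔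
         (⟦𝓕 β ⟧ ⊨ AP [ (α , α∈) ∷ (δ , δ∈) ∷ [] ])
≢∨≢⇔AP β α δ α∈ δ∈ = mk⇔
  (λ ap (γ , γ∈) → ∨-map (_∘ lower) (_∘ lower) (ap γ γ∈))
  (λ ap γ γ∈ → ∨-map (_∘ lift) (_∘ lift) (ap (γ , γ∈)))

theorem4p5 : BCP → (β : 𝒩) → Spr β → (α δ : 𝒩) (α∈ : α ∈ 𝓕 β) (δ∈ : δ ∈ 𝓕 β) →
    (α # δ ⇔ (⟦𝓕 β ⟧ ⊨ AP [ (α , α∈) ∷ (δ , δ∈) ∷ [] ])) ×
    (α # δ ⇔ (∀ γ → γ ∈ 𝓕 β → ¬ (γ ≗ α) ∨ ¬ (γ ≗ δ)))
theorem4p5 bcp β _ α δ α∈ δ∈ =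
  ≢∨≢⇔AP β α δ α∈ δ∈ ⇔-∘ #⇔≢∨≢ bcp β α δ α∈ δ∈ , #⇔≢∨≢ bcp β α δ α∈ δ∈
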